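{- Given an arrangement of $n$ $d$-dimensional flats in $\mathbb{R}^{2d}$ such that no two flats are parallel. If the number of pairs with zero dimensional (single point) intersection is $o(n^2)$, then one can remove $o(n)$ flats such that the intersections of the remaining pairs have dimension at least one.
   Context: A $d$-dimensional flat in $\mathbb{R}^{2d}$ is a $d$-dimensional affine subspace. Parallel has its usual meaning: two $d$-dimensional flats are parallel if one is a translate of the other. For two functions over the reals, $f(x)$ and $g(x)$, one writes $f(x)=o(g(x))$ if $f(x)/g(x)\to 0$ as $x\to\infty$; here $d$ is fixed and the asymptotics are in the number $n$ of flats, as $n\to\infty$.
   Formalization: The conclusion is stated only for remaining pairs that do intersect, since non-parallel flats may be disjoint: the planes l_i × R in R^4 over pairwise skew lines l_i have no point intersections, yet every pair is disjoint. -}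

module Defs where

open import Algebra.Bundles using (CommutativeRing)
import Algebra.Definitions.RawMonoid as RawMonoidDefinitions
open import Axiom.ExcludedMiddle using (ExcludedMiddle)
open import Data.Fin.Base as Fin using (Fin)
open import Data.List.Base using (allFin; cartesianProduct; filter; length)
open import Data.Nat.Base as ℕ using (ℕ; suc)
open import Data.Product.Base using (∃; ∃-syntax; _×_; _,_)
open import Data.Vec.Functional using (Vector)
open import Function.Bundles using (_⇔_)
open import Level using (0ℓ) renaming (suc to lsuc)
open import Relation.Binary.Core using (Rel)
open import Relation.Binary.PropositionalEquality.Core using (_≢_)
open import Relation.Binary.Structures using (IsTotalOrder)
open import Relation.Nullary.Negation using (¬_)
open import Relation.Unary using (Pred; Satisfiable; _∈_; _∩_)

-- A complete ordered field. Up to isomorphism there is exactly one, so a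
-- statement about an arbitrary one is a statement about the real numbers.
record CompleteOrderedField : Set (lsuc 0ℓ) where
  infix 4 _≤_
  field
    commutativeRing : CommutativeRing 0ℓ 0ℓ

  open CommutativeRing commutativeRing public

  field
    0≉1          : ¬ (0# ≈ 1#)
    inverse      : ∀ x → ¬ (x ≈ 0#) → ∃[ y ] (x * y ≈ 1#)
    _≤_          : Rel Carrier 0ℓ
    isTotalOrder : IsTotalOrder _≈_ _≤_
    +-monoʳ-≤    : ∀ z {x y} → x ≤ y → z + x ≤ z + y
    *-nonneg     : ∀ {x y} → 0# ≤ x → 0# ≤ y → 0# ≤ x * y

  UpperBound : Pred Carrier 0ℓ → Pred Carrier 0ℓ
  UpperBound P b = ∀ x → x ∈ P → x ≤ b

  field
    complete : ∀ P → Satisfiable P → Satisfiable (UpperBound P) →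
               ∃[ s ] (s ∈ UpperBound P × (∀ b → b ∈ UpperBound P → s ≤ b))

-- f(n) / g(n) → 0, with the tolerances ε = 1 / (k + 1).
infix 4 _=o_
_=o_ : (ℕ → ℕ) → (ℕ → ℕ) → Set
f =o g = ∀ k → ∃[ N ] (∀ n → N ℕ.≤ n → suc k ℕ.* f n ℕ.≤ g n)

module Flats (ℝ : CompleteOrderedField) where

  open CompleteOrderedField ℝ
  open RawMonoidDefinitions +-rawMonoid using (sum)

  Space : ℕ → Set
  Space m = Vector Carrier m

  infix 4 _≋_
  _≋_ : ∀ {m} → Rel (Space m) 0ℓ
  x ≋ y = ∀ i → x i ≈ y i

  infixl 6 _⊕_
  _⊕_ : ∀ {m} → Space m → Space m → Space m
  (x ⊕ y) i = x i + y i

  𝟎 : ∀ {m} → Space m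
  𝟎 _ = 0#

  combination : ∀ {k m} → Vector Carrier k → Vector (Space m) k → Space m
  combination c v i = sum (λ j → c j * v j i)

  LinearlyIndependent : ∀ {k m} → Vector (Space m) k → Set
  LinearlyIndependent v = ∀ c → combination c v ≋ 𝟎 → ∀ j → c j ≈ 0#

  -- S is a k-dimensional affine subspace: a translate p + span(v₁, …, vₖ)
  -- with v₁, …, vₖ linearly independent. For k = 0 this is a single point;
  -- the empty set is not a flat of any dimension.
  IsFlat : ∀ {m} → ℕ → Pred (Space m) 0ℓ → Set
  IsFlat {m} k S =
    ∃[ p ] ∃ λ (v : Vector (Space m) k) →
      LinearlyIndependent v ×
      (∀ x → x ∈ S ⇔ (∃[ c ] (x ≋ p ⊕ combination c v)))

  Parallel : ∀ {m} → Rel (Pred (Space m) 0ℓ) 0ℓ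
  Parallel {m} S T = ∃ λ (t : Space m) → ∀ x → x ∈ S ⇔ (x ⊕ t) ∈ T

  record Arrangement (d n : ℕ) : Set₁ where
    field
      flat   : Fin n → Pred (Space (2 ℕ.* d)) 0ℓ
      isFlat : ∀ i → IsFlat d (flat i)

  open Arrangement public

  NoTwoParallel : ∀ {d n} → Arrangement d n → Set
  NoTwoParallel A = ∀ i j → i ≢ j → ¬ Parallel (flat A i) (flat A j)

  -- Unordered pairs of flats are counted as index pairs (i , j) with i < j.
  -- Excluded middle is what makes the property counted decidable.
  #pointPairs : ExcludedMiddle 0ℓ → ∀ {d n} → Arrangement d n → ℕ
  #pointPairs em {n = n} A =
    length (filter (λ ij → em {P = IsPointPair ij})
                   (cartesianProduct (allFin n) (allFin n)))
    where
    IsPointPair : Pred (Fin n × Fin n) 0ℓ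
    IsPointPair (i , j) = i Fin.< j × IsFlat 0 (flat A i ∩ flat A j)

  DimensionAtLeastOne : ∀ {m} → Pred (Space m) 0ℓ → Set
  DimensionAtLeastOne S = ∃[ k ] (1 ℕ.≤ k × IsFlat k S)

{-# OPTIONS --safe #-}
module Submission where

-- Two of the flats meet in a single point as soon as their direction spaces are
-- transversal, that is, if bases v of one and w of the other together form a
-- basis of the whole space; otherwise they are disjoint or meet in a flat of
-- dimension at least one.
--
-- Some polynomial in v and the coordinates adapted to w is 1 when v is the
-- partner of w and vanishes when v and w are not transversal. Such a polynomial
-- is a sum of r products of a function of v and a function of w, where r depends
-- on d only, so a matrix of its values has rank at most r. Hence there are no
-- r + 1 transversal pairs (aₖ , bₖ) such that aₖ and bₗ are non-transversal
-- whenever k ≠ l.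
--
-- Remove the vertices of a maximal matching of the transversality graph. Calling
-- two matching edges adjacent if a transversal pair joins an end of one to an end
-- of the other in this sense, no r + 1 of the m matching edges are pairwise
-- non-adjacent, so as in Turán's theorem at least m² / (2 r) pairs are
-- transversal. Thus m² ≤ 2 r f(n) = o(n²).

open import Defs
open import Axiom.ExcludedMiddle using (ExcludedMiddle)
open import Data.Fin.Subset using (Subset; ∣_∣; _∉_)
open import Data.Nat using (ℕ; _^_; _≤_)
open import Data.Product using (_×_; Σ-syntax)
open import Level using (0ℓ)
open import Relation.Binary.PropositionalEquality using (_≢_)
open import Relation.Unary using (_∩_; Satisfiable)

import Algebra.Properties.AbelianGroup
import Algebra.Properties.Ring
import Algebra.Properties.Semiring.Sum
import Algebra.Solver.Ring.NaturalCoefficients.Default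
open import Data.Fin as Fin using (Fin; zero; suc; punchIn; punchOut; splitAt; _↑ˡ_; _↑ʳ_; inject≤)
import Data.Fin.Properties as Fin
open import Data.Fin.Subset as Subset using (inside; outside)
import Data.Fin.Subset.Properties as Subset
open import Data.List as List using (List; length; concatMap; lookup)
open import Data.List.Membership.Propositional using (_∈_; find)
open import Data.List.Membership.Propositional.Properties
  using (∈-∃++; ∈-lookup; ∈-++⁺ˡ; ∈-++⁺ʳ; ∈-++⁻; ∈-filter⁺; ∈-cartesianProduct⁺; ∈-allFin)
open import Data.List.Properties using (length-++)
open import Data.List.Relation.Binary.Disjoint.Propositional using (Disjoint)
open import Data.List.Relation.Binary.Permutation.Propositional as ↭ using (_↭_; ↭-sym)
open import Data.List.Relation.Binary.Permutation.Propositional.Properties using (∈-resp-↭; shifts)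
open import Data.List.Relation.Binary.Permutation.Setoid.Properties using (Unique-resp-↭)
open import Data.List.Relation.Binary.Subset.Propositional using (_⊆_)
open import Data.List.Relation.Unary.All as All using (All)
import Data.List.Relation.Unary.All.Properties as All
open import Data.List.Relation.Unary.AllPairs using (AllPairs)
open import Data.List.Relation.Unary.Any using (Any; here; there)
open import Data.List.Relation.Unary.Unique.Propositional using (Unique)
import Data.List.Relation.Unary.Unique.Propositional.Properties as Unique
open import Data.Nat as ℕ using (zero; suc)
import Data.Nat.Properties as ℕ
open import Data.Nat.Solver using (module +-*-Solver)
open import Data.Product using (∃; ∃₂; ∃-syntax; _,_; proj₁; proj₂; uncurry; swap)
open import Data.Sum using (_⊎_; inj₁; inj₂; [_,_]′)
import Data.Vec.Base as Vec
open import Function using (_∘_; id; case_of_; _⇔_; mk⇔; module Equivalence)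
open import Relation.Binary.Core using (Rel)
open import Relation.Binary.Definitions using (Symmetric; tri<; tri≈; tri>)
open import Relation.Binary.PropositionalEquality as ≡ using (_≡_)
import Relation.Binary.Reasoning.Setoid
open import Relation.Nullary using (¬_; yes; no; contradiction)
open import Relation.Nullary.Decidable using (decidable-stable)
open import Relation.Unary using (Pred)

module LinearAlgebra (em : ExcludedMiddle 0ℓ) (ℝ : CompleteOrderedField) where

  open import Data.Vec.Functional using (Vector; _∷_; tail; _++_; removeAt)
  open import Data.Vec.Functional.Properties using (lookup-++ˡ; lookup-++ʳ)
  open CompleteOrderedField ℝ hiding (_≤_; zero)
  open Flats ℝ
  open Algebra.Properties.Semiring.Sum semiring
  open Algebra.Properties.Ring ring using (-‿distribˡ-*)
  open Algebra.Properties.AbelianGroup +-abelianGroup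
    using (inverseˡ-unique; inverseʳ-unique; xyx⁻¹≈y; ⁻¹-∙-comm)
  open Algebra.Solver.Ring.NaturalCoefficients.Default commutativeSemiring
    using (solve; _:+_; _:*_; _:=_)
  open Relation.Binary.Reasoning.Setoid setoid

  -- Linear combinations, dependence and spans.

  Nonzero : ∀ {n} → Space n → Set
  Nonzero c = ∃[ j ] ¬ (c j ≈ 0#)

  Dependent : ∀ {k n} → Vector (Space n) k → Set
  Dependent v = ∃[ c ] Nonzero c × combination c v ≋ 𝟎

  Span : ∀ {k n} → Vector (Space n) k → Pred (Space n) 0ℓ
  Span v x = ∃[ c ] (x ≋ combination c v)

  zero⊎Nonzero : ∀ {n} (c : Space n) → c ≋ 𝟎 ⊎ Nonzero c
  zero⊎Nonzero c with em {c ≋ 𝟎}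
  ... | yes c≋𝟎 = inj₁ c≋𝟎
  ... | no  c≉𝟎 = inj₂ (Fin.¬∀⟶∃¬ _ _ (λ _ → em) c≉𝟎)

  dependent : ∀ {k n} {v : Vector (Space n) k} → ¬ LinearlyIndependent v → Dependent v
  dependent {v = v} ¬li = decidable-stable em λ ¬dep → ¬li λ c cv≋𝟎 →
    case zero⊎Nonzero c of λ where
      (inj₁ c≋𝟎) → c≋𝟎
      (inj₂ c≢𝟎) → contradiction (c , c≢𝟎 , cv≋𝟎) ¬dep

  independent⇒¬dependent : ∀ {k n} (v : Vector (Space n) k) →
                           LinearlyIndependent v → ¬ Dependent v
  independent⇒¬dependent v li (c , (j , cⱼ≉0) , cv≋𝟎) = cⱼ≉0 (li c cv≋𝟎 j)

  x*y≈0⇒y≈0 : ∀ {x y} → ¬ (x ≈ 0#) → x * y ≈ 0# → y ≈ 0#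
  x*y≈0⇒y≈0 {x} {y} x≉0 xy≈0 with inverse x x≉0
  ... | z , xz≈1 = begin
    y            ≈⟨ *-identityˡ y ⟨
    1# * y       ≈⟨ *-congʳ xz≈1 ⟨
    (x * z) * y  ≈⟨ solve 3 (λ x y z → (x :* z) :* y := z :* (x :* y)) refl x y z ⟩
    z * (x * y)  ≈⟨ *-congˡ xy≈0 ⟩
    z * 0#       ≈⟨ zeroʳ z ⟩
    0#           ∎

  sum-0 : ∀ {n} {f : Vector Carrier n} → f ≋ 𝟎 → sum f ≈ 0#
  sum-0 {n} f≋𝟎 = trans (sum-cong-≋ f≋𝟎) (sum-replicate-zero n)

  sum-single : ∀ {n} (f : Vector Carrier n) i → (∀ j → j ≢ i → f j ≈ 0#) → sum f ≈ f i
  sum-single {suc n} f i f≈0 = begin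
    sum f                     ≈⟨ sum-remove f ⟩
    f i + sum (removeAt f i)  ≈⟨ +-congˡ (sum-0 λ j → f≈0 _ (Fin.punchInᵢ≢i i j)) ⟩
    f i + 0#                  ≈⟨ +-identityʳ (f i) ⟩
    f i                       ∎

  sum-++ : ∀ {m n} (f : Vector Carrier (m ℕ.+ n)) →
           sum f ≈ sum (f ∘ (_↑ˡ n)) + sum (f ∘ (m ↑ʳ_))
  sum-++ {zero}  f = sym (+-identityˡ _)
  sum-++ {suc m} f = trans (+-congˡ (sum-++ {m} (f ∘ suc))) (sym (+-assoc _ _ _))

  sum-neg : ∀ {n} (f : Vector Carrier n) → sum (λ i → - f i) ≈ - sum f
  sum-neg f = inverseʳ-unique _ _
    (trans (sym (∑-distrib-+ f (λ i → - f i))) (sum-0 λ i → -‿inverseʳ (f i)))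

  combination-congˡ : ∀ {k n} {c c′ : Vector Carrier k} (v : Vector (Space n) k) →
                      c ≋ c′ → combination c v ≋ combination c′ v
  combination-congˡ v c≋c′ i = sum-cong-≋ λ j → *-congʳ (c≋c′ j)

  combination-congʳ : ∀ {k n} (c : Vector Carrier k) {v v′ : Vector (Space n) k} →
                      (∀ j → v j ≋ v′ j) → combination c v ≋ combination c v′
  combination-congʳ c v≋v′ i = sum-cong-≋ λ j → *-congˡ (v≋v′ j i)

  combination-𝟎 : ∀ {k n} {c : Vector Carrier k} (v : Vector (Space n) k) →
                  c ≋ 𝟎 → combination c v ≋ 𝟎
  combination-𝟎 v c≋𝟎 i = sum-0 λ j → trans (*-congʳ (c≋𝟎 j)) (zeroˡ (v j i))

  combination-⊕ : ∀ {k n} (c c′ : Vector Carrier k) (v : Vector (Space n) k) →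
                  combination (c ⊕ c′) v ≋ combination c v ⊕ combination c′ v
  combination-⊕ c c′ v i =
    trans (sum-cong-≋ λ j → distribʳ (v j i) (c j) (c′ j))
          (∑-distrib-+ (λ j → c j * v j i) (λ j → c′ j * v j i))

  combination-* : ∀ {k n} a (c : Vector Carrier k) (v : Vector (Space n) k) i →
                  combination (λ j → a * c j) v i ≈ a * combination c v i
  combination-* a c v i =
    trans (sum-cong-≋ λ j → *-assoc a (c j) (v j i))
          (sym (*-distribˡ-sum a (λ j → c j * v j i)))

  combination-neg : ∀ {k n} (c : Vector Carrier k) (v : Vector (Space n) k) i →
                    combination (λ j → - c j) v i ≈ - combination c v i
  combination-neg c v i =
    trans (sum-cong-≋ λ j → sym (-‿distribˡ-* (c j) (v j i))) (sum-neg (λ j → c j * v j i))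

  -- This is associativity of the matrix product `c q v`, obtained by interchanging the two
  -- summations. It is the tool for every change of coefficients below.
  combination-combination :
    ∀ {k l n} (c : Vector Carrier k) (q : Vector (Space l) k) (v : Vector (Space n) l) →
    combination c (λ j → combination (q j) v) ≋ combination (combination c q) v
  combination-combination c q v i = begin
    sum (λ j → c j * sum (λ s → q j s * v s i))
      ≈⟨ sum-cong-≋ (λ j → *-distribˡ-sum (c j) (λ s → q j s * v s i)) ⟩
    sum (λ j → sum (λ s → c j * (q j s * v s i)))
      ≈⟨ ∑-comm (λ j s → c j * (q j s * v s i)) ⟩
    sum (λ s → sum (λ j → c j * (q j s * v s i)))
      ≈⟨ sum-cong-≋ (λ s → sum-cong-≋ (λ j → *-assoc (c j) (q j s) (v s i))) ⟨
    sum (λ s → sum (λ j → c j * q j s * v s i))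
      ≈⟨ sum-cong-≋ (λ s → *-distribʳ-sum (v s i) (λ j → c j * q j s)) ⟨
    sum (λ s → sum (λ j → c j * q j s) * v s i) ∎

  combination-++ : ∀ {k l n} (c : Vector Carrier (k ℕ.+ l))
                   (v : Vector (Space n) k) (w : Vector (Space n) l) →
                   combination c (v ++ w) ≋
                   combination (c ∘ (_↑ˡ l)) v ⊕ combination (c ∘ (k ↑ʳ_)) w
  combination-++ {k} {l} c v w i = trans (sum-++ {k} λ j → c j * (v ++ w) j i) (+-cong
    (sum-cong-≋ λ j → *-congˡ (reflexive (≡.cong (λ x → x i) (lookup-++ˡ v w j))))
    (sum-cong-≋ λ j → *-congˡ (reflexive (≡.cong (λ x → x i) (lookup-++ʳ v w j)))))

  δ : ∀ {n} → Vector (Space n) n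
  δ zero    zero    = 1#
  δ zero    (suc j) = 0#
  δ (suc i) zero    = 0#
  δ (suc i) (suc j) = δ i j

  combination-δ : ∀ {n} (c : Space n) → combination c δ ≋ c
  combination-δ c zero = begin
    c zero * 1# + combination (tail c) (λ j → δ (suc j)) zero
      ≈⟨ +-cong (*-identityʳ _) (sum-0 λ j → zeroʳ (tail c j)) ⟩
    c zero + 0#  ≈⟨ +-identityʳ _ ⟩
    c zero       ∎
  combination-δ c (suc i) = begin
    c zero * 0# + combination (tail c) δ i ≈⟨ +-cong (zeroʳ _) (combination-δ (tail c) i) ⟩
    0# + c (suc i)                         ≈⟨ +-identityˡ _ ⟩
    c (suc i)                              ∎

  -- Induction on the dimension by elimination. A zero first vector is itself a relation; otherwise
  -- one of its nonzero coordinates serves as a pivot, and clearing that coordinate from the other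
  -- vectors leaves `suc n` vectors with one coordinate fewer, whose relation lifts back.
  suc-n-dependent : ∀ {n} (v : Vector (Space n) (suc n)) → Dependent v
  suc-n-dependent {zero}  v = (λ _ → 1#) , (zero , λ 1≈0 → 0≉1 (sym 1≈0)) , λ ()
  suc-n-dependent {suc n} v with zero⊎Nonzero (v zero)
  ... | inj₁ v₀≋𝟎 = 1# ∷ 𝟎 , (zero , λ 1≈0 → 0≉1 (sym 1≈0)) , λ i → begin
    1# * v zero i + combination 𝟎 (tail v) i
      ≈⟨ +-cong (trans (*-identityˡ _) (v₀≋𝟎 i)) (combination-𝟎 (tail v) (λ _ → refl) i) ⟩
    0# + 0#  ≈⟨ +-identityˡ 0# ⟩
    0#       ∎
  ... | inj₂ (i , a≉0) with suc-n-dependent w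
    where
    w : Vector (Space n) (suc n)
    -- Coordinate `i` of this multiple of `v (suc j)` has been cleared by subtracting a multiple of
    -- `v zero`; `punchIn i` then skips it.
    w j k = v zero i * v (suc j) (punchIn i k) + - v (suc j) i * v zero (punchIn i k)
  ... | c , (j , cⱼ≉0) , cw≋𝟎 = c′ , (suc j , c′ⱼ≉0) , c′v≋𝟎
    where
    a = v zero i
    c′ : Space (2 ℕ.+ n)
    -- Substituting the definition of `w` into its relation, the first vector collects all the
    -- subtracted multiples and every other coefficient is scaled by the pivot.
    c′ = sum (λ j → c j * - v (suc j) i) ∷ λ j → a * c j
    c′ⱼ≉0 : ¬ (a * c j ≈ 0#)
    c′ⱼ≉0 acⱼ≈0 = cⱼ≉0 (x*y≈0⇒y≈0 a≉0 acⱼ≈0)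
    expand : ∀ l → combination c′ v l ≈
                   sum (λ j → c j * (a * v (suc j) l + - v (suc j) i * v zero l))
    expand l = begin
      sum (λ j → c j * - v (suc j) i) * v zero l + sum (λ j → a * c j * v (suc j) l)
        ≈⟨ +-congʳ (*-distribʳ-sum (v zero l) (λ j → c j * - v (suc j) i)) ⟩
      sum (λ j → c j * - v (suc j) i * v zero l) + sum (λ j → a * c j * v (suc j) l)
        ≈⟨ ∑-distrib-+ (λ j → c j * - v (suc j) i * v zero l) (λ j → a * c j * v (suc j) l) ⟨
      sum (λ j → c j * - v (suc j) i * v zero l + a * c j * v (suc j) l)
        ≈⟨ sum-cong-≋ (λ j → solve 5
             (λ c b v₀ a vⱼ → c :* b :* v₀ :+ a :* c :* vⱼ := c :* (a :* vⱼ :+ b :* v₀))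
             refl (c j) (- v (suc j) i) (v zero l) a (v (suc j) l)) ⟩
      sum (λ j → c j * (a * v (suc j) l + - v (suc j) i * v zero l)) ∎
    c′v≋𝟎 : combination c′ v ≋ 𝟎
    c′v≋𝟎 l with i Fin.≟ l
    -- At the pivot coordinate each summand vanishes by itself; every other coordinate is one of
    -- `w`, where the relation holds by induction.
    ... | yes ≡.refl = trans (expand i) (sum-0 λ j → trans (*-congˡ (begin
      a * v (suc j) i + - v (suc j) i * a  ≈⟨ +-congˡ (*-comm _ a) ⟩
      a * v (suc j) i + a * - v (suc j) i  ≈⟨ distribˡ a _ _ ⟨
      a * (v (suc j) i + - v (suc j) i)    ≈⟨ *-congˡ (-‿inverseʳ _) ⟩
      a * 0#                               ≈⟨ zeroʳ a ⟩
      0#                                   ∎)) (zeroʳ (c j)))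
    ... | no i≢l = ≡.subst (λ l → combination c′ v l ≈ 0#) (Fin.punchIn-punchOut i≢l)
                     (trans (expand _) (cw≋𝟎 (punchOut i≢l)))

  ∷-dependent⇒Span : ∀ {k n} (x : Space n) (v : Vector (Space n) k) c → ¬ (c zero ≈ 0#) →
                     combination c (x ∷ v) ≋ 𝟎 → Span v x
  ∷-dependent⇒Span x v c c₀≉0 eq with inverse (c zero) c₀≉0
  ... | b , c₀b≈1 = (λ j → - b * c (suc j)) , λ i → begin
    x i                                         ≈⟨ inverseˡ-unique _ _ (zero-sum i) ⟩
    - (b * combination (tail c) v i)            ≈⟨ -‿distribˡ-* b _ ⟩
    - b * combination (tail c) v i              ≈⟨ combination-* (- b) (tail c) v i ⟨
    combination (λ j → - b * c (suc j)) v i     ∎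
    where
    zero-sum : ∀ i → x i + b * combination (tail c) v i ≈ 0#
    zero-sum i = begin
      x i + b * S                     ≈⟨ +-congʳ (trans (*-congʳ c₀b≈1) (*-identityˡ _)) ⟨
      c zero * b * x i + b * S        ≈⟨ solve 4 (λ c b x s → c :* b :* x :+ b :* s := b :* (c :* x :+ s))
                                           refl (c zero) b (x i) S ⟩
      b * (c zero * x i + S)          ≈⟨ *-congˡ (eq i) ⟩
      b * 0#                          ≈⟨ zeroʳ b ⟩
      0#                              ∎
      where S = combination (tail c) v i

  extend-independent : ∀ {k n} (x : Space n) (v : Vector (Space n) k) → LinearlyIndependent v →
                       ¬ Span v x → LinearlyIndependent (x ∷ v)
  extend-independent x v li x∉span c eq =
    λ where zero    → c₀≈0
            (suc j) → li (tail c) rest j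
    where
    c₀≈0 : c zero ≈ 0#
    c₀≈0 = decidable-stable em λ c₀≉0 → x∉span (∷-dependent⇒Span x v c c₀≉0 eq)
    rest : combination (tail c) v ≋ 𝟎
    rest i = begin
      combination (tail c) v i                 ≈⟨ +-identityˡ _ ⟨
      0# + combination (tail c) v i            ≈⟨ +-congʳ (trans (*-congʳ c₀≈0) (zeroˡ (x i))) ⟨
      c zero * x i + combination (tail c) v i  ≈⟨ eq i ⟩
      0#                                       ∎

  -- A vector outside the span would extend `v` to `suc n` independent vectors in dimension `n`.
  independent⇒spanning : ∀ {n} (v : Vector (Space n) n) → LinearlyIndependent v → ∀ x → Span v x
  independent⇒spanning v li x = decidable-stable em λ x∉span →
    independent⇒¬dependent (x ∷ v) (extend-independent x v li x∉span) (suc-n-dependent (x ∷ v))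

  -- Subspaces and their bases.

  record IsSubspace {n} (U : Pred (Space n) 0ℓ) : Set where
    field
      respects : ∀ {x y} → x ≋ y → U x → U y
      closed   : ∀ {k} (c : Vector Carrier k) {v} → (∀ j → U (v j)) → U (combination c v)

  Basis : ∀ {n} → Pred (Space n) 0ℓ → ℕ → Set
  Basis {n} U k = ∃ λ (v : Vector (Space n) k) → LinearlyIndependent v × (∀ x → U x ⇔ Span v x)

  -- Vectors of `U` outside the current span are added greedily. The equation on `fuel` records that
  -- the family can grow at most to `suc n` members, a size at which independence is impossible.
  extend-to-basis : ∀ {n} {U : Pred (Space n) 0ℓ} → IsSubspace U →
                    ∀ fuel {k} (v : Vector (Space n) k) → fuel ℕ.+ k ≡ suc n →
                    LinearlyIndependent v → (∀ j → U (v j)) → ∃[ l ] k ≤ l × Basis U l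
  extend-to-basis isSubspace zero v ≡.refl li v⊆U =
    contradiction (suc-n-dependent v) (independent⇒¬dependent v li)
  extend-to-basis {U = U} isSubspace (suc fuel) {k} v eq li v⊆U with em {∃[ x ] U x × ¬ Span v x}
  ... | no  spans = k , ℕ.≤-refl , v , li , λ x → mk⇔
          (λ x∈U → decidable-stable em λ x∉span → spans (x , x∈U , x∉span))
          (λ (c , x≋cv) → respects (λ i → sym (x≋cv i)) (closed c v⊆U))
    where open IsSubspace isSubspace
  ... | yes (x , x∈U , x∉span)
    with extend-to-basis isSubspace fuel (x ∷ v) (≡.trans (ℕ.+-suc fuel k) eq)
           (extend-independent x v li x∉span)
           (λ where
              zero    → x∈U
              (suc j) → v⊆U j)
  ... | l , k<l , basis = l , ℕ.<⇒≤ k<l , basis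

  nonzero-basis : ∀ {n} {U : Pred (Space n) 0ℓ} → IsSubspace U →
                  ∀ {z} → U z → Nonzero z → ∃[ l ] 1 ≤ l × Basis U l
  nonzero-basis {n} isSubspace {z} z∈U (i , zᵢ≉0) =
    extend-to-basis isSubspace n (λ _ → z) (ℕ.+-comm n 1) li (λ _ → z∈U)
    where
    li : LinearlyIndependent {1} (λ _ → z)
    li c cz≋𝟎 zero = x*y≈0⇒y≈0 zᵢ≉0
      (trans (*-comm _ _) (trans (sym (+-identityʳ _)) (cz≋𝟎 i)))

  -- Fraction-free elimination and the product of its pivots.

  eliminate : ∀ {n} → Vector (Space (suc n)) (suc n) → Vector (Space n) n
  -- Row `suc j` is scaled by the pivot and a multiple of row `zero` is subtracted. The first column
  -- becomes zero and is dropped; no division occurs, so the entries stay polynomial.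
  eliminate M j i = M zero zero * M (suc j) (suc i) + - M zero (suc i) * M (suc j) zero

  -- The product of the pivots of fraction-free Gaussian elimination without row
  -- exchanges: a multiple of the determinant that is polynomial in the entries. A
  -- pivot may vanish for an independent family too, so it has to be evaluated in
  -- coordinates in which the family of interest is δ.
  pivotProduct : ∀ {n} → Vector (Space n) n → Carrier
  pivotProduct {zero}  M = 1#
  pivotProduct {suc n} M = M zero zero * pivotProduct (eliminate M)

  pivotProduct-cong : ∀ {n} {M N : Vector (Space n) n} → (∀ j → M j ≋ N j) →
                      pivotProduct M ≈ pivotProduct N
  pivotProduct-cong {zero}  M≋N = refl
  pivotProduct-cong {suc n} M≋N = *-cong (M≋N zero zero) (pivotProduct-cong λ j i → +-cong
    (*-cong (M≋N zero zero) (M≋N (suc j) (suc i)))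
    (*-cong (-‿cong (M≋N zero (suc i))) (M≋N (suc j) zero)))

  pivotProduct-δ : ∀ {n} → pivotProduct (δ {n}) ≈ 1#
  pivotProduct-δ {zero}  = refl
  pivotProduct-δ {suc n} =
    trans (*-identityˡ _) (trans (pivotProduct-cong {n} eliminate-δ) (pivotProduct-δ {n}))
    where
    eliminate-δ : ∀ j → eliminate δ j ≋ δ j
    eliminate-δ j i = trans (+-cong (*-identityˡ _) (zeroʳ _)) (+-identityʳ _)

  -- If the relation involves a row after the first, its tail is a relation between the eliminated
  -- rows and induction applies. Otherwise the first row is zero, and so is the first pivot.
  pivotProduct-dependent : ∀ {n} (M : Vector (Space n) n) → Dependent M → pivotProduct M ≈ 0#
  pivotProduct-dependent {suc n} M (c , c≢𝟎 , cM≋𝟎) with zero⊎Nonzero (tail c)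
  ... | inj₂ c′≢𝟎 =
    trans (*-congˡ (pivotProduct-dependent (eliminate M) (tail c , c′≢𝟎 , relation))) (zeroʳ _)
    where
    relation : combination (tail c) (eliminate M) ≋ 𝟎
    relation i = begin
      sum (λ j → tail c j * (a * M (suc j) (suc i) + - b * M (suc j) zero))
        ≈⟨ sum-cong-≋ (λ j → solve 5
             (λ c a x b y → c :* (a :* x :+ b :* y) := a :* (c :* x) :+ b :* (c :* y))
             refl (tail c j) a (M (suc j) (suc i)) (- b) (M (suc j) zero)) ⟩
      sum (λ j → a * (tail c j * M (suc j) (suc i)) + - b * (tail c j * M (suc j) zero))
        ≈⟨ ∑-distrib-+ (λ j → a * (tail c j * M (suc j) (suc i)))
                       (λ j → - b * (tail c j * M (suc j) zero)) ⟩
      sum (λ j → a * (tail c j * M (suc j) (suc i))) + sum (λ j → - b * (tail c j * M (suc j) zero))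
        ≈⟨ +-cong (*-distribˡ-sum a (λ j → tail c j * M (suc j) (suc i)))
                  (*-distribˡ-sum (- b) (λ j → tail c j * M (suc j) zero)) ⟨
      a * S (suc i) + - b * S zero
        ≈⟨ +-identityʳ _ ⟨
      a * S (suc i) + - b * S zero + 0#
        ≈⟨ +-congˡ (trans (*-congˡ (-‿inverseʳ b)) (zeroʳ _)) ⟨
      -- The inserted term is zero. Its two halves supply the contribution of the first row to
      -- columns `suc i` and `zero`, completing both partial sums to the relation for `M`.
      a * S (suc i) + - b * S zero + c zero * a * (b + - b)
        ≈⟨ solve 6 (λ c a b b′ s t →
             a :* s :+ b′ :* t :+ c :* a :* (b :+ b′) := a :* (c :* b :+ s) :+ b′ :* (c :* a :+ t))
             refl (c zero) a b (- b) (S (suc i)) (S zero) ⟩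
      a * (c zero * b + S (suc i)) + - b * (c zero * a + S zero)
        ≈⟨ +-cong (trans (*-congˡ (cM≋𝟎 (suc i))) (zeroʳ a))
                  (trans (*-congˡ (cM≋𝟎 zero)) (zeroʳ (- b))) ⟩
      0# + 0#
        ≈⟨ +-identityˡ 0# ⟩
      0# ∎
      where
      a = M zero zero
      b = M zero (suc i)
      S = combination (tail c) (λ j → M (suc j))
  ... | inj₁ c′≋𝟎 = trans (*-congʳ (x*y≈0⇒y≈0 (c₀≉0 c≢𝟎) (begin
      c zero * M zero zero  ≈⟨ +-identityʳ _ ⟨
      c zero * M zero zero + 0#
        ≈⟨ +-congˡ (combination-𝟎 (λ j → M (suc j)) c′≋𝟎 zero) ⟨
      combination c M zero  ≈⟨ cM≋𝟎 zero ⟩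
      0#                    ∎))) (zeroˡ _)
    where
    c₀≉0 : Nonzero c → ¬ (c zero ≈ 0#)
    c₀≉0 (zero  , c₀≉0) = c₀≉0
    c₀≉0 (suc j , cⱼ≉0) = contradiction (c′≋𝟎 j) cⱼ≉0

  -- Functions of two variables of finite rank.

  record Separable {X Y : Set} (h : X → Y → Carrier) : Set where
    constructor separable
    field
      -- The number of products in one chosen decomposition, hence only an upper bound for the rank
      -- of a matrix of values of `h`.
      rank  : ℕ
      left  : Vector (X → Carrier) rank
      right : Vector (Y → Carrier) rank
      split : ∀ x y → h x y ≈ sum (λ s → left s x * right s y)

  module _ {X Y : Set} where

    private variable
      h k : X → Y → Carrier

    separable-left : (f : X → Carrier) → Separable {X} {Y} (λ x y → f x)
    separable-left f = separable 1 (λ _ → f) (λ _ _ → 1#)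
      λ x y → sym (trans (+-identityʳ _) (*-identityʳ _))

    separable-right : (f : Y → Carrier) → Separable {X} {Y} (λ x y → f y)
    separable-right f = separable 1 (λ _ _ → 1#) (λ _ → f)
      λ x y → sym (trans (+-identityʳ _) (*-identityˡ _))

    separable-+ : Separable h → Separable k → Separable (λ x y → h x y + k x y)
    separable-+ (separable r φ ψ h≈) (separable s φ′ ψ′ k≈) =
      separable (r ℕ.+ s) (φ ++ φ′) (ψ ++ ψ′) λ x y → trans
        (+-cong
          (trans (h≈ x y) (sum-cong-≋ λ i → reflexive (≡.sym (≡.cong₂ (λ f g → f x * g y)
            (lookup-++ˡ φ φ′ i) (lookup-++ˡ ψ ψ′ i)))))
          (trans (k≈ x y) (sum-cong-≋ λ i → reflexive (≡.sym (≡.cong₂ (λ f g → f x * g y)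
            (lookup-++ʳ φ φ′ i) (lookup-++ʳ ψ ψ′ i))))))
        (sym (sum-++ {r} λ i → (φ ++ φ′) i x * (ψ ++ ψ′) i y))

    separable-cong : (∀ x y → h x y ≈ k x y) → Separable h → Separable k
    separable-cong h≈k (separable r φ ψ h≈) =
      separable r φ ψ λ x y → trans (sym (h≈k x y)) (h≈ x y)

    separable-sum : ∀ {n} {h : Fin n → X → Y → Carrier} → (∀ i → Separable (h i)) →
                    Separable (λ x y → sum (λ i → h i x y))
    separable-sum {zero}  sep = separable 0 (λ ()) (λ ()) λ _ _ → refl
    separable-sum {suc n} sep = separable-+ (sep zero) (separable-sum (λ i → sep (suc i)))

    separable-* : Separable h → Separable k → Separable (λ x y → h x y * k x y)
    separable-* {h} {k} (separable r φ ψ h≈) (separable s φ′ ψ′ k≈) =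
      separable-cong
        (λ x y → trans (sym (*-distribʳ-sum (k x y) (λ i → φ i x * ψ i y))) (*-congʳ (sym (h≈ x y))))
        (separable-sum λ i → separable s (λ j x → φ i x * φ′ j x) (λ j y → ψ i y * ψ′ j y) λ x y →
          begin
            φ i x * ψ i y * k x y
              ≈⟨ *-congˡ (k≈ x y) ⟩
            φ i x * ψ i y * sum (λ j → φ′ j x * ψ′ j y)
              ≈⟨ *-distribˡ-sum (φ i x * ψ i y) (λ j → φ′ j x * ψ′ j y) ⟩
            sum (λ j → φ i x * ψ i y * (φ′ j x * ψ′ j y))
              ≈⟨ sum-cong-≋ (λ j → solve 4 (λ a b c d → a :* b :* (c :* d) := a :* c :* (b :* d))
                   refl (φ i x) (ψ i y) (φ′ j x) (ψ′ j y)) ⟩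
            sum (λ j → φ i x * φ′ j x * (ψ i y * ψ′ j y)) ∎)

    separable-neg : Separable h → Separable (λ x y → - h x y)
    separable-neg (separable r φ ψ h≈) = separable r (λ s x → - φ s x) ψ λ x y →
      trans (-‿cong (h≈ x y)) (trans (sym (sum-neg (λ s → φ s x * ψ s y)))
        (sum-cong-≋ λ s → -‿distribˡ-* (φ s x) (ψ s y)))

    -- The product of pivots is a polynomial in the entries, and separable functions are closed
    -- under sums, products and negation.
    separable-pivotProduct : ∀ {n} {M : X → Y → Vector (Space n) n} →
                             (∀ j i → Separable (λ x y → M x y j i)) →
                             Separable (λ x y → pivotProduct (M x y))
    separable-pivotProduct {zero}  sep = separable-left (λ _ → 1#)
    separable-pivotProduct {suc n} sep =
      separable-* (sep zero zero) (separable-pivotProduct λ j i → separable-+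
      (separable-* (sep zero zero) (sep (suc j) (suc i)))
      (separable-* (separable-neg (sep zero (suc i))) (sep (suc j) zero)))

    -- The values form a diagonal matrix with nonzero diagonal. More than `r` rows would be
    -- dependent, because each is determined linearly by a vector of length `r`; evaluating the
    -- relation in a column `l` with nonzero coefficient isolates a diagonal entry and makes it
    -- zero.
    rank-bound : (sep : Separable h) → ∀ {t} (x : Fin t → X) (y : Fin t → Y) →
                 (∀ i → ¬ (h (x i) (y i) ≈ 0#)) → (∀ i j → i ≢ j → h (x i) (y j) ≈ 0#) →
                 t ≤ Separable.rank sep
    rank-bound {h} (separable r φ ψ h≈) {t} x y diagonal off-diagonal = ℕ.≮⇒≥ λ r<t →
      let ι = λ (i : Fin (suc r)) → inject≤ i r<t
          Φ = λ (i : Fin (suc r)) s → φ s (x (ι i))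
          c , (l , cₗ≉0) , relation = suc-n-dependent Φ
          -- The numbers `ψ s` are treated as vectors with one coordinate, so that the laws of
          -- `combination` apply.
          Ψ = λ s (_ : Fin 1) → ψ s (y (ι l))
      in diagonal (ι l) (x*y≈0⇒y≈0 cₗ≉0 (begin
        c l * h (x (ι l)) (y (ι l))
          ≈⟨ sum-single (λ i → c i * h (x (ι i)) (y (ι l))) l (λ i i≢l → trans
               (*-congˡ (off-diagonal (ι i) (ι l) (i≢l ∘ Fin.inject≤-injective r<t r<t i l)))
               (zeroʳ (c i))) ⟨
        sum (λ i → c i * h (x (ι i)) (y (ι l)))
          ≈⟨ combination-congʳ {n = 1} c (λ i _ → h≈ (x (ι i)) (y (ι l))) zero ⟩
        combination c (λ i → combination (Φ i) Ψ) zero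
          ≈⟨ combination-combination c Φ Ψ zero ⟩
        combination (combination c Φ) Ψ zero
          ≈⟨ combination-𝟎 Ψ relation zero ⟩
        0# ∎))

  -- A bound on systems of transversal pairs.

  Transversal : ∀ {d m} → Vector (Space m) d → Vector (Space m) d → Set
  Transversal v w = LinearlyIndependent (v ++ w)

  -- The function `h` is 1 on each pair of partners and vanishes on the other pairs, so `rank-bound`
  -- applies. The decomposition `sep` is constructed before the families are given, which makes `r`
  -- uniform in `t`, `v` and `w`.
  transversal-bound : ∀ {d m} → m ≡ d ℕ.+ d → ∃[ r ] ∀ {t} (v w : Fin t → Vector (Space m) d) →
    (∀ i → Transversal (v i) (w i)) → (∀ i j → i ≢ j → ¬ Transversal (v i) (w j)) → t ≤ r
  transversal-bound {d} {m} ≡.refl = Separable.rank sep , bound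
    where
    h : Vector (Space m) d → Vector (Space m) d × Vector (Space m) m → Carrier
    -- The coefficients `Q` of the adapted coordinates go with `w` in the second variable. Each
    -- matrix entry is then a sum of products of an entry of `Q` and an entry of `v` or `w`, hence
    -- separable.
    h v (w , Q) = pivotProduct λ j → combination (Q j) (v ++ w)

    sep : Separable h
    sep = separable-pivotProduct λ j i → separable-sum λ s → separable-*
            (separable-right λ (w , Q) → Q j s) (entry s i)
      where
      entry : ∀ s i → Separable {Y = Vector (Space m) d × Vector (Space m) m}
                                (λ v (w , Q) → (v ++ w) s i)
      entry s i with splitAt d s
      ... | inj₁ s′ = separable-left λ v → v s′ i
      ... | inj₂ s′ = separable-right λ (w , Q) → w s′ i

    bound : ∀ {t} (v w : Fin t → Vector (Space m) d) → (∀ i → Transversal (v i) (w i)) →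
            (∀ i j → i ≢ j → ¬ Transversal (v i) (w j)) → t ≤ Separable.rank sep
    bound {t} v w diagonal off-diagonal =
      rank-bound sep v (λ i → w i , Q i) nonvanishing vanishing
      where
      u : ∀ i j → Vector (Space m) m
      u i j = v i ++ w j

      -- Combining with the coefficients Q i turns v i ++ w i into the standard basis.
      Q : Fin t → Vector (Space m) m
      Q i j = proj₁ (independent⇒spanning (u i i) (diagonal i) (δ j))

      uQ≋δ : ∀ i j → combination (Q i j) (u i i) ≋ δ j
      uQ≋δ i j k = sym (proj₂ (independent⇒spanning (u i i) (diagonal i) (δ j)) k)

      -- `Q i` has a right inverse, namely `u i i`: multiplying a relation `c` between its rows by
      -- `u i i` gives back `c`.
      Q-independent : ∀ i → LinearlyIndependent (Q i)
      Q-independent i c cQ≋𝟎 j = begin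
        c j                                                ≈⟨ combination-δ c j ⟨
        combination c δ j                                  ≈⟨ combination-congʳ c (uQ≋δ i) j ⟨
        combination c (λ j → combination (Q i j) (u i i)) j ≈⟨ combination-combination c (Q i) (u i i) j ⟩
        combination (combination c (Q i)) (u i i) j        ≈⟨ combination-𝟎 (u i i) cQ≋𝟎 j ⟩
        0#                                                 ∎

      nonvanishing : ∀ i → ¬ (h (v i) (w i , Q i) ≈ 0#)
      nonvanishing i h≈0 = 0≉1 (trans (sym h≈0) (trans (pivotProduct-cong (uQ≋δ i)) (pivotProduct-δ {m})))

      vanishing : ∀ i j → i ≢ j → h (v i) (w j , Q j) ≈ 0#
      vanishing i j i≢j with dependent (off-diagonal i j i≢j)
      -- A relation `c` of `u i j` concerns the vectors before the coordinate change. Since the rows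
      -- of `Q j` form a basis, `c` can be written as `y` times `Q j`, and `y` is a relation after
      -- the change.
      ... | c , (l , cₗ≉0) , cu≋𝟎 with independent⇒spanning (Q j) (Q-independent j) c
      ... | y , c≋yQ = pivotProduct-dependent _ (y , nonzero , relation)
        where
        nonzero : Nonzero y
        nonzero with zero⊎Nonzero y
        ... | inj₁ y≋𝟎 = contradiction (trans (c≋yQ l) (combination-𝟎 (Q j) y≋𝟎 l)) cₗ≉0
        ... | inj₂ y≢𝟎 = y≢𝟎
        relation : combination y (λ k → combination (Q j k) (u i j)) ≋ 𝟎
        relation k = begin
          combination y (λ k → combination (Q j k) (u i j)) k ≈⟨ combination-combination y (Q j) (u i j) k ⟩
          combination (combination y (Q j)) (u i j) k         ≈⟨ combination-congˡ (u i j) c≋yQ k ⟨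
          combination c (u i j) k                             ≈⟨ cu≋𝟎 k ⟩
          0#                                                  ∎

  -- Intersections of two flats.

  combination-++-++ : ∀ {k l n} (a : Vector Carrier k) (b : Vector Carrier l)
                      (v : Vector (Space n) k) (w : Vector (Space n) l) →
                      combination (a ++ b) (v ++ w) ≋ combination a v ⊕ combination b w
  combination-++-++ a b v w i = trans (combination-++ (a ++ b) v w i) (+-cong
    (combination-congˡ v (λ j → reflexive (lookup-++ˡ a b j)) i)
    (combination-congˡ w (λ j → reflexive (lookup-++ʳ a b j)) i))

  infixl 6 _⊖_
  _⊖_ : ∀ {n} → Space n → Space n → Space n
  (x ⊖ y) i = x i + - y i

  combination-⊖ : ∀ {k n} (a b : Vector Carrier k) (v : Vector (Space n) k) →
                  combination (a ⊖ b) v ≋ combination a v ⊖ combination b v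
  combination-⊖ a b v i = trans (combination-⊕ a (λ j → - b j) v i) (+-congˡ (combination-neg b v i))

  x≈y+z⇒x-y≈z : ∀ {x y z} → x ≈ y + z → x + - y ≈ z
  x≈y+z⇒x-y≈z {x} {y} {z} x≈y+z = trans (+-congʳ x≈y+z) (xyx⁻¹≈y y z)

  x-y≈z⇒x≈y+z : ∀ {x y z} → x + - y ≈ z → x ≈ y + z
  x-y≈z⇒x≈y+z {x} {y} {z} x-y≈z = begin
    x                ≈⟨ xyx⁻¹≈y y x ⟨
    y + x + - y      ≈⟨ +-assoc _ _ _ ⟩
    y + (x + - y)    ≈⟨ +-congˡ x-y≈z ⟩
    y + z            ∎

  Span-isSubspace : ∀ {k n} (v : Vector (Space n) k) → IsSubspace (Span v)
  Span-isSubspace v = record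
    { respects = λ x≋y (c , x≋cv) → c , λ i → trans (sym (x≋y i)) (x≋cv i)
    ; closed   = λ c x∈span → combination c (λ j → proj₁ (x∈span j)) , λ i → trans
        (combination-congʳ c (λ j → proj₂ (x∈span j)) i)
        (combination-combination c (λ j → proj₁ (x∈span j)) v i)
    }

  ∩-isSubspace : ∀ {n} {U V : Pred (Space n) 0ℓ} →
                 IsSubspace U → IsSubspace V → IsSubspace (U ∩ V)
  ∩-isSubspace isU isV = record
    { respects = λ x≋y (x∈U , x∈V) → U.respects x≋y x∈U , V.respects x≋y x∈V
    ; closed   = λ c v∈U∩V → U.closed c (λ j → proj₁ (v∈U∩V j)) ,
                             V.closed c (λ j → proj₂ (v∈U∩V j))
    }
    where module U = IsSubspace isU
          module V = IsSubspace isV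

  directions : ∀ {k m} {S : Pred (Space m) 0ℓ} → IsFlat k S → Vector (Space m) k
  directions (_ , v , _) = v

  module _ {k m} {S : Pred (Space m) 0ℓ} (flat : IsFlat k S) where

    private
      p  = proj₁ flat
      v  = directions {S = S} flat
      ∈S = proj₂ (proj₂ (proj₂ flat))

    -- Any point of a flat can serve as its base point. With a common base point, intersecting two
    -- flats reduces to intersecting their direction spaces.
    ∈⇔⊖∈Span : ∀ {x₀} → S x₀ → ∀ x → S x ⇔ Span v (x ⊖ x₀)
    ∈⇔⊖∈Span {x₀} x₀∈S x with Equivalence.to (∈S x₀) x₀∈S
    ... | b , x₀≋p+bv = mk⇔
      (λ x∈S → let a , x≋p+av = Equivalence.to (∈S x) x∈S in a ⊖ b , λ i → begin
        x i + - x₀ i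
          ≈⟨ +-cong (x≋p+av i) (trans (-‿cong (x₀≋p+bv i)) (sym (⁻¹-∙-comm _ _))) ⟩
        p i + combination a v i + (- p i + - combination b v i)
          ≈⟨ solve 4 (λ p a p′ b → p :+ a :+ (p′ :+ b) := p :+ p′ :+ (a :+ b))
               refl (p i) (combination a v i) (- p i) (- combination b v i) ⟩
        p i + - p i + (combination a v i + - combination b v i)
          ≈⟨ +-congʳ (-‿inverseʳ (p i)) ⟩
        0# + (combination a v i + - combination b v i)
          ≈⟨ +-identityˡ _ ⟩
        combination a v i + - combination b v i
          ≈⟨ combination-⊖ a b v i ⟨
        combination (a ⊖ b) v i ∎)
      (λ (c , x⊖x₀≋cv) → Equivalence.from (∈S x) (b ⊕ c , λ i → begin
        x i                                              ≈⟨ x-y≈z⇒x≈y+z (x⊖x₀≋cv i) ⟩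
        x₀ i + combination c v i                         ≈⟨ +-congʳ (x₀≋p+bv i) ⟩
        p i + combination b v i + combination c v i      ≈⟨ +-assoc _ _ _ ⟩
        p i + (combination b v i + combination c v i)    ≈⟨ +-congˡ (combination-⊕ b c v i) ⟨
        p i + combination (b ⊕ c) v i                    ∎))

  module _ {d m} {S T : Pred (Space m) 0ℓ} (flatS : IsFlat d S) (flatT : IsFlat d T) where

    private
      v = directions {S = S} flatS
      w = directions {S = T} flatT

    -- Writing the difference of the base points as `q - p = av + bw` gives the common point
    -- `p + av = q - bw`. A second common point would differ from it by a vector in both spans,
    -- which independence of `v ++ w` forces to be zero.
    transversal⇒point : m ≡ d ℕ.+ d → Transversal v w → IsFlat 0 (S ∩ T)
    transversal⇒point ≡.refl li =
      x₀ , (λ ()) , (λ _ _ ()) , λ x → mk⇔ (λ x∈ → (λ ()) , unique x∈) member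
      where
      spanning = independent⇒spanning (v ++ w) li (proj₁ flatT ⊖ proj₁ flatS)
      c    = proj₁ spanning
      q⊖p≋ = proj₂ spanning
      p  = proj₁ flatS
      q  = proj₁ flatT
      ∈S = proj₂ (proj₂ (proj₂ flatS))
      ∈T = proj₂ (proj₂ (proj₂ flatT))
      a  = c ∘ (_↑ˡ d)
      b  = c ∘ (d ↑ʳ_)
      x₀ = p ⊕ combination a v

      x₀≋ : x₀ ≋ q ⊕ combination (λ j → - b j) w
      x₀≋ i = begin
        p i + av                 ≈⟨ xyx⁻¹≈y bw _ ⟨
        bw + (p i + av) + - bw   ≈⟨ +-congʳ (solve 3 (λ b p a → b :+ (p :+ a) := p :+ (a :+ b))
                                      refl bw (p i) av) ⟩
        p i + (av + bw) + - bw   ≈⟨ +-congʳ (x-y≈z⇒x≈y+z (trans (q⊖p≋ i) (combination-++ c v w i))) ⟨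
        q i + - bw               ≈⟨ +-congˡ (combination-neg b w i) ⟨
        q i + combination (λ j → - b j) w i ∎
        where av = combination a v i
              bw = combination b w i

      x₀∈S : S x₀
      x₀∈S = Equivalence.from (∈S x₀) (a , λ _ → refl)

      x₀∈T : T x₀
      x₀∈T = Equivalence.from (∈T x₀) ((λ j → - b j) , x₀≋)

      unique : ∀ {x} → (S ∩ T) x → x ≋ x₀ ⊕ combination {0} (λ ()) (λ ())
      unique {x} (x∈S , x∈T) i = x-y≈z⇒x≈y+z (trans (x⊖x₀≋sv i) (combination-𝟎 v s≋𝟎 i))
        where
        inS = Equivalence.to (∈⇔⊖∈Span {S = S} flatS x₀∈S x) x∈S
        inT = Equivalence.to (∈⇔⊖∈Span {S = T} flatT x₀∈T x) x∈T
        s = proj₁ inS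
        t = proj₁ inT
        x⊖x₀≋sv = proj₂ inS
        x⊖x₀≋tw = proj₂ inT
        s-t : Vector Carrier (d ℕ.+ d)
        s-t = s ++ λ j → - t j
        relation : combination s-t (v ++ w) ≋ 𝟎
        relation i = begin
          combination s-t (v ++ w) i
            ≈⟨ combination-++-++ s (λ j → - t j) v w i ⟩
          combination s v i + combination (λ j → - t j) w i
            ≈⟨ +-cong (sym (x⊖x₀≋sv i)) (combination-neg t w i) ⟩
          (x ⊖ x₀) i + - combination t w i
            ≈⟨ +-congʳ (x⊖x₀≋tw i) ⟩
          combination t w i + - combination t w i
            ≈⟨ -‿inverseʳ _ ⟩
          0# ∎
        s≋𝟎 : s ≋ 𝟎
        s≋𝟎 j = trans (reflexive (≡.sym (lookup-++ˡ s (λ j → - t j) j))) (li s-t relation (j ↑ˡ d))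

      member : ∀ {x} → (∃[ e ] x ≋ x₀ ⊕ combination e (λ ())) → (S ∩ T) x
      member {x} (_ , x≋x₀+0) =
        Equivalence.from (∈S x) (a , x≋x₀) ,
        Equivalence.from (∈T x) ((λ j → - b j) , λ i → trans (x≋x₀ i) (x₀≋ i))
        where
        x≋x₀ : x ≋ x₀
        x≋x₀ i = trans (x≋x₀+0 i) (+-identityʳ _)

    -- A relation `av + bw = 0` places `z = av = -bw` in both direction spaces. If `z` were zero,
    -- independence of `v` and of `w` would make all coefficients zero; so the common directions
    -- have a nonempty basis, and translating their span by `x₀` gives the intersection.
    ¬transversal⇒dimension≥1 : ¬ Transversal v w → Satisfiable (S ∩ T) →
                               DimensionAtLeastOne (S ∩ T)
    ¬transversal⇒dimension≥1 ¬li (x₀ , x₀∈S , x₀∈T) with dependent ¬li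
    ... | c , (j , cⱼ≉0) , c≋𝟎
      with nonzero-basis (∩-isSubspace (Span-isSubspace v) (Span-isSubspace w)) {z} z∈U z≢𝟎
      where
      a = c ∘ (_↑ˡ d)
      b = c ∘ (d ↑ʳ_)
      z = combination a v
      z≋-bw : z ≋ combination (λ j → - b j) w
      z≋-bw i = trans (inverseˡ-unique _ _ (trans (sym (combination-++ c v w i)) (c≋𝟎 i)))
                      (sym (combination-neg b w i))
      z∈U : (Span v ∩ Span w) z
      z∈U = (a , λ _ → refl) , ((λ j → - b j) , z≋-bw)
      z≢𝟎 : Nonzero z
      z≢𝟎 with zero⊎Nonzero z
      ... | inj₂ z≢𝟎 = z≢𝟎
      ... | inj₁ z≋𝟎 = contradiction (vanish j) cⱼ≉0
        where
        bw≋𝟎 : combination b w ≋ 𝟎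
        bw≋𝟎 i = begin
          combination b w i        ≈⟨ +-identityˡ _ ⟨
          0# + combination b w i   ≈⟨ +-congʳ (z≋𝟎 i) ⟨
          z i + combination b w i  ≈⟨ combination-++ c v w i ⟨
          combination c (v ++ w) i ≈⟨ c≋𝟎 i ⟩
          0#                       ∎
        vanish : ∀ j → c j ≈ 0#
        vanish j with splitAt d j in eq
        ... | inj₁ j′ rewrite ≡.sym (Fin.splitAt⁻¹-↑ˡ {i = j} eq) =
                proj₁ (proj₂ (proj₂ flatS)) a z≋𝟎 j′
        ... | inj₂ j′ rewrite ≡.sym (Fin.splitAt⁻¹-↑ʳ {i = j} eq) =
                proj₁ (proj₂ (proj₂ flatT)) b bw≋𝟎 j′
    ... | l , 1≤l , u , u-li , ∈U = l , 1≤l , x₀ , u , u-li , λ x → mk⇔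
      (λ (x∈S , x∈T) →
        let e , x⊖x₀≋eu = Equivalence.to (∈U (x ⊖ x₀))
              ( Equivalence.to (∈⇔⊖∈Span {S = S} flatS x₀∈S x) x∈S
              , Equivalence.to (∈⇔⊖∈Span {S = T} flatT x₀∈T x) x∈T)
        in e , λ i → x-y≈z⇒x≈y+z (x⊖x₀≋eu i))
      (λ (e , x≋x₀+eu) →
        let sv , tw = Equivalence.from (∈U (x ⊖ x₀)) (e , λ i → x≈y+z⇒x-y≈z (x≋x₀+eu i))
        in Equivalence.from (∈⇔⊖∈Span {S = S} flatS x₀∈S x) sv ,
           Equivalence.from (∈⇔⊖∈Span {S = T} flatT x₀∈T x) tw)

open import Data.List using ([]; _∷_)
open import Data.List.Relation.Unary.All using ([]; _∷_)
open import Data.List.Relation.Unary.AllPairs using ([]; _∷_)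
open import Data.Vec.Functional using (Vector)

-- Duplicate-free lists, finite subsets and integer square roots.

module _ {A : Set} where

  -- One occurrence of the head is cut out of `ys`; the tail avoids the head, so it still lies in
  -- what is left.
  unique-⊆-length : ∀ {xs ys : List A} → Unique xs → xs ⊆ ys → length xs ≤ length ys
  unique-⊆-length {[]}     _              _     = ℕ.z≤n
  unique-⊆-length {x ∷ xs} {ys} (x∉xs ∷ uxs) xs⊆ys with ∈-∃++ (xs⊆ys (here ≡.refl))
  ... | as , bs , ≡.refl = begin
    suc (length xs)                 ≤⟨ ℕ.s≤s (unique-⊆-length uxs xs⊆as++bs) ⟩
    suc (length (as List.++ bs))    ≡⟨ ≡.cong suc (length-++ as) ⟩
    suc (length as ℕ.+ length bs)   ≡⟨ ℕ.+-suc (length as) (length bs) ⟨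
    length as ℕ.+ length (x ∷ bs)   ≡⟨ length-++ as ⟨
    length (as List.++ x ∷ bs)      ∎
    where
    open ℕ.≤-Reasoning
    xs⊆as++bs : xs ⊆ as List.++ bs
    xs⊆as++bs y∈xs with ∈-++⁻ as (xs⊆ys (there y∈xs))
    ... | inj₁ y∈as           = ∈-++⁺ˡ y∈as
    ... | inj₂ (here ≡.refl)  = contradiction ≡.refl (All.lookup x∉xs y∈xs)
    ... | inj₂ (there y∈bs)   = ∈-++⁺ʳ as y∈bs

  unique-++⁻ : ∀ (xs : List A) {ys} → Unique (xs List.++ ys) →
               Unique xs × Unique ys × Disjoint xs ys
  unique-++⁻ []       uys          = [] , uys , λ ()
  unique-++⁻ (x ∷ xs) (x∉ ∷ u) with unique-++⁻ xs u | All.++⁻ xs x∉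
  ... | uxs , uys , disjoint | x∉xs , x∉ys = x∉xs ∷ uxs , uys , λ where
    (here ≡.refl , y∈ys) → contradiction ≡.refl (All.lookup x∉ys y∈ys)
    (there y∈xs , y∈ys)  → disjoint (y∈xs , y∈ys)

  allPairs-lookup : ∀ {R : Rel A 0ℓ} → Symmetric R → ∀ {xs} → AllPairs R xs →
                    ∀ i j → i ≢ j → R (lookup xs i) (lookup xs j)
  allPairs-lookup R-sym (rs ∷ prs) zero    zero    0≢0 = contradiction ≡.refl 0≢0
  allPairs-lookup R-sym (rs ∷ prs) zero    (suc j) _   = All.lookup rs (∈-lookup j)
  allPairs-lookup R-sym (rs ∷ prs) (suc i) zero    _   = R-sym (All.lookup rs (∈-lookup i))
  allPairs-lookup R-sym (rs ∷ prs) (suc i) (suc j) i≢j =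
    allPairs-lookup R-sym prs i j (i≢j ∘ ≡.cong suc)

∣p∪q∣≤∣p∣+∣q∣ : ∀ {n} (p q : Subset n) → ∣ p Subset.∪ q ∣ ≤ ∣ p ∣ ℕ.+ ∣ q ∣
∣p∪q∣≤∣p∣+∣q∣ Vec.[] Vec.[] = ℕ.z≤n
∣p∪q∣≤∣p∣+∣q∣ (inside Vec.∷ p) (inside Vec.∷ q) =
  ℕ.s≤s (ℕ.≤-trans (∣p∪q∣≤∣p∣+∣q∣ p q) (ℕ.+-monoʳ-≤ ∣ p ∣ (ℕ.n≤1+n ∣ q ∣)))
∣p∪q∣≤∣p∣+∣q∣ (inside Vec.∷ p) (outside Vec.∷ q) = ℕ.s≤s (∣p∪q∣≤∣p∣+∣q∣ p q)
∣p∪q∣≤∣p∣+∣q∣ (outside Vec.∷ p) (inside Vec.∷ q) rewrite ℕ.+-suc ∣ p ∣ ∣ q ∣ =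
  ℕ.s≤s (∣p∪q∣≤∣p∣+∣q∣ p q)
∣p∪q∣≤∣p∣+∣q∣ (outside Vec.∷ p) (outside Vec.∷ q) = ∣p∪q∣≤∣p∣+∣q∣ p q

fromList : ∀ {n} → List (Fin n) → Subset n
fromList = List.foldr (λ x p → Subset.⁅ x ⁆ Subset.∪ p) Subset.⊥

∣fromList∣≤length : ∀ {n} (xs : List (Fin n)) → ∣ fromList xs ∣ ≤ length xs
∣fromList∣≤length {n} []       = ℕ.≤-reflexive (Subset.∣⊥∣≡0 n)
∣fromList∣≤length     (x ∷ xs) = ℕ.≤-trans (∣p∪q∣≤∣p∣+∣q∣ Subset.⁅ x ⁆ (fromList xs))
  (ℕ.+-mono-≤ (ℕ.≤-reflexive (Subset.∣⁅x⁆∣≡1 x)) (∣fromList∣≤length xs))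

∈-fromList : ∀ {n} {x : Fin n} {xs} → x ∈ xs → x Subset.∈ fromList xs
∈-fromList {xs = y ∷ xs} (here ≡.refl) = Subset.x∈p∪q⁺ (inj₁ (Subset.x∈⁅x⁆ y))
∈-fromList {xs = y ∷ xs} (there x∈xs)  = Subset.x∈p∪q⁺ (inj₂ (∈-fromList x∈xs))

-- The integer square root of `x`, by induction: passing from `x` to `suc x` raises it by at most
-- one, since `suc s` squared at most `suc x` gives `s` squared at most `x`.
√-bounds : ∀ x → ∃[ q ] q ℕ.* q ≤ x × (∀ s → s ℕ.* s ≤ x → s ≤ q)
√-bounds zero = 0 , ℕ.z≤n , λ where
  zero _ → ℕ.z≤n
√-bounds (suc x) with √-bounds x
... | q , q²≤x , q-max with suc q ℕ.* suc q ℕ.≤? suc x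
... | yes sq²≤sx = suc q , sq²≤sx , λ where
        zero    _        → ℕ.z≤n
        (suc s) s²≤sx    → ℕ.s≤s (q-max s (ℕ.≤-pred (ℕ.≤-trans (ℕ.*-mono-< (ℕ.n<1+n s) (ℕ.n<1+n s)) s²≤sx)))
... | no  sq²≰sx = q , ℕ.m≤n⇒m≤1+n q²≤x , λ s s²≤sx →
        ℕ.≮⇒≥ λ q<s → sq²≰sx (ℕ.≤-trans (ℕ.*-mono-≤ q<s q<s) s²≤sx)

m²≤n²⇒m≤n : ∀ {m n} → m ℕ.* m ≤ n ℕ.* n → m ≤ n
m²≤n²⇒m≤n m²≤n² = ℕ.≮⇒≥ λ n<m → ℕ.<⇒≱ (ℕ.*-mono-< n<m n<m) m²≤n²

-- Matchings and independent sets of matching edges.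

module Matchings {n} (em : ExcludedMiddle 0ℓ) (E P : Rel (Fin n) 0ℓ)
                 (E⇒P : ∀ {a b} → E a b → P a b) (P-sym : Symmetric P) where

  Pair : Set
  Pair = Fin n × Fin n

  ends : Pair → List (Fin n)
  ends (a , b) = a ∷ b ∷ []

  verts : List Pair → List (Fin n)
  verts = concatMap ends

  length-verts : ∀ M → length (verts M) ≡ 2 ℕ.* length M
  length-verts []      = ≡.refl
  length-verts (u ∷ M) = ≡.trans (≡.cong (2 ℕ.+_) (length-verts M))
                                 (≡.sym (ℕ.*-suc 2 (length M)))

  -- Greedy choice along the list. Uniqueness of `verts M` says at once that each edge has two
  -- distinct ends and that different edges are disjoint.
  maximal-matching : ∀ ps → ∃[ M ] Unique (verts M) × All (uncurry E) M ×
    (∀ {a b} → (a , b) ∈ ps → a ≢ b → E a b → a ∈ verts M ⊎ b ∈ verts M)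
  maximal-matching [] = [] , [] , [] , λ ()
  maximal-matching ((a , b) ∷ ps) with maximal-matching ps
  ... | M , uM , eM , covers
    with em {a ≢ b × E a b × ¬ a ∈ verts M × ¬ b ∈ verts M}
  ... | yes (a≢b , eab , a∉M , b∉M) =
        (a , b) ∷ M , (a≢b ∷ fresh a∉M) ∷ fresh b∉M ∷ uM , eab ∷ eM , λ where
          (here ≡.refl) _ _   → inj₁ (here ≡.refl)
          (there p∈ps) c≢d ecd →
            [ inj₁ ∘ there ∘ there , inj₂ ∘ there ∘ there ]′ (covers p∈ps c≢d ecd)
    where
    fresh : ∀ {x} → ¬ x ∈ verts M → All (x ≢_) (verts M)
    fresh x∉M = All.tabulate λ y∈M → λ { ≡.refl → x∉M y∈M }
  ... | no  blocked = M , uM , eM , covers′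
    where
    covers′ : ∀ {c d} → (c , d) ∈ (a , b) ∷ ps → c ≢ d → E c d → c ∈ verts M ⊎ d ∈ verts M
    covers′ (there p∈ps) c≢d ecd = covers p∈ps c≢d ecd
    covers′ (here ≡.refl) a≢b eab with em {a ∈ verts M} | em {b ∈ verts M}
    ... | yes a∈M | _       = inj₁ a∈M
    ... | no  _   | yes b∈M = inj₂ b∈M
    ... | no  a∉M | no  b∉M = contradiction (a≢b , eab , a∉M , b∉M) blocked

  Ordered : Pair → Set
  Ordered (i , j) = i Fin.< j × P i j

  -- Counted pairs are increasing while `E` has a direction of its own. The symmetry of `P` allows
  -- the ends to be swapped, and the permutation remembers which vertices they are.
  orient : ∀ {a b} → a ≢ b → P a b → ∃[ p ] Ordered p × ends p ↭ a ∷ b ∷ []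
  orient {a} {b} a≢b pab with Fin.<-cmp a b
  ... | tri< a<b _ _ = (a , b) , (a<b , pab) , ↭.refl
  ... | tri≈ _ a≡b _ = contradiction a≡b a≢b
  ... | tri> _ _ b<a = (b , a) , (b<a , P-sym pab) , ↭.swap b a ↭.refl

  -- Certificates for telling pairs apart: a pair with an end in one set cannot equal a pair lying
  -- inside a disjoint set.
  Hits Within : List (Fin n) → Pair → Set
  Hits   S p = ∃[ x ] x ∈ ends p × x ∈ S
  Within S p = ∀ x → x ∈ ends p → x ∈ S

  -- The pair chosen for `u` stays within `S` and the ends of `u`, whereas each pair chosen for a
  -- later edge touches an end of a later edge. These vertex sets are disjoint, so the choices are
  -- distinct.
  pick : ∀ {Q : Pair → Set} S L → Unique (verts L) → Disjoint S (verts L) →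
         All (λ u → ∃[ p ] Q p × Hits (ends u) p × Within (S List.++ ends u) p) L →
         ∃[ ps ] length ps ≡ length L × Unique ps ×
                 All (λ p → Q p × Hits (verts L) p × Within (S List.++ verts L) p) ps
  pick S [] _ _ [] = [] , ≡.refl , [] , []
  pick S (u@(a , b) ∷ L) uuL S#uL ((p , q , (x , x∈p , x∈u) , p⊆) ∷ choices)
    with unique-++⁻ (ends u) uuL
  ... | _ , uL , u#L
    with pick S L uL (λ (x∈S , x∈L) → S#uL (x∈S , ∈-++⁺ʳ (ends u) x∈L)) choices
  ... | ps , len , ups , good =
    p ∷ ps , ≡.cong suc len ,
    All.map (λ (_ , (y , y∈p′ , y∈L) , _) → λ { ≡.refl → fresh (p⊆ y y∈p′) y∈L }) good ∷ ups ,
    (q , (x , x∈p , ∈-++⁺ˡ x∈u) , λ y y∈p → grow₁ (p⊆ y y∈p)) ∷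
    All.map (λ (q , (y , y∈p , y∈L) , p⊆) →
      q , (y , y∈p , ∈-++⁺ʳ (ends u) y∈L) , λ z z∈p → grow₂ (p⊆ z z∈p)) good
    where
    fresh : ∀ {y} → y ∈ S List.++ ends u → ¬ y ∈ verts L
    fresh y∈ y∈L with ∈-++⁻ S y∈
    ... | inj₁ y∈S = S#uL (y∈S , ∈-++⁺ʳ (ends u) y∈L)
    ... | inj₂ y∈u = u#L (y∈u , y∈L)
    grow₁ : S List.++ ends u ⊆ S List.++ verts (u ∷ L)
    grow₁ y∈ with ∈-++⁻ S y∈
    ... | inj₁ y∈S = ∈-++⁺ˡ y∈S
    ... | inj₂ y∈u = ∈-++⁺ʳ S (∈-++⁺ˡ y∈u)
    grow₂ : S List.++ verts L ⊆ S List.++ verts (u ∷ L)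
    grow₂ y∈ with ∈-++⁻ S y∈
    ... | inj₁ y∈S = ∈-++⁺ˡ y∈S
    ... | inj₂ y∈L = ∈-++⁺ʳ S (∈-++⁺ʳ (ends u) y∈L)

  -- Only a first end is compared with a second end, as in `transversal-bound`, where the first ends
  -- form the family `v` and the second ends the family `w`.
  Adjacent : Rel Pair 0ℓ
  Adjacent (a , b) (c , d) = E a d ⊎ E c b

  NonAdjacent : Rel Pair 0ℓ
  NonAdjacent u w = ¬ Adjacent u w

  -- Each edge joins `I` unless it is adjacent to a member already there, in which case it goes to
  -- `L`. The last component makes `L` strictly shorter than a nonempty `M`.
  maximal-independent : ∀ M → All (uncurry E) M → ∃₂ λ I L →
    verts M ↭ verts I List.++ verts L × length M ≡ length I ℕ.+ length L ×
    All (uncurry E) I × All (uncurry E) L ×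
    AllPairs NonAdjacent I × All (λ u → Any (Adjacent u) I) L × (length I ≡ 0 → length M ≡ 0)
  maximal-independent [] [] = [] , [] , ↭.refl , ≡.refl , [] , [] , [] , [] , id
  maximal-independent (u ∷ M) (eu ∷ eM) with maximal-independent M eM
  ... | I , L , M↭ , len , eI , eL , ind , adj , _ with em {Any (Adjacent u) I}
  ... | yes adj-u = I , u ∷ L ,
        ↭.trans (↭.prep _ (↭.prep _ M↭)) (shifts (ends u) (verts I)) ,
        ≡.trans (≡.cong suc len) (≡.sym (ℕ.+-suc (length I) (length L))) ,
        eI , eu ∷ eL , ind , adj-u ∷ adj , nonempty adj-u
    where
    nonempty : ∀ {I} → Any (Adjacent u) I → length I ≡ 0 → length (u ∷ M) ≡ 0
    nonempty (here _)  ()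
    nonempty (there _) ()
  ... | no ¬adj-u = u ∷ I , L , ↭.prep _ (↭.prep _ M↭) , ≡.cong suc len ,
        eu ∷ eI , eL , All.¬Any⇒All¬ I ¬adj-u ∷ ind , All.map there adj , λ ()

  ∈-verts : ∀ {x u M} → x ∈ ends u → u ∈ M → x ∈ verts M
  ∈-verts             x∈u (here ≡.refl) = ∈-++⁺ˡ x∈u
  ∈-verts {M = w ∷ M} x∈u (there u∈M)   = ∈-++⁺ʳ (ends w) (∈-verts x∈u u∈M)

  inner-pairs : ∀ I → Unique (verts I) → All (uncurry E) I →
                All (λ u → ∃[ p ] Ordered p × Hits (ends u) p × Within (ends u) p) I
  inner-pairs [] _ [] = []
  inner-pairs ((a , b) ∷ I) ((a≢b ∷ _) ∷ _ ∷ uI) (eab ∷ eI) with orient a≢b (E⇒P eab)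
  ... | p , ordered , p↭ =
    (p , ordered , (a , ∈-resp-↭ (↭-sym p↭) (here ≡.refl) , here ≡.refl) , λ _ → ∈-resp-↭ p↭) ∷
    inner-pairs I uI eI

  -- Adjacency to a member of `I` provides a transversal pair from an end of `u` to an end of that
  -- member; the two ends differ because the vertex sets are disjoint.
  cross-pairs : ∀ I L → Disjoint (verts I) (verts L) → All (λ u → Any (Adjacent u) I) L →
                All (λ u → ∃[ p ] (Ordered p × Hits (verts I) p) × Hits (ends u) p ×
                                  Within (verts I List.++ ends u) p) L
  cross-pairs I [] _ [] = []
  cross-pairs I (u@(a , b) ∷ L) I#uL (adj-u ∷ adj) =
    new (find adj-u) ∷ cross-pairs I L (λ (x∈I , x∈L) → I#uL (x∈I , ∈-++⁺ʳ (ends u) x∈L)) adj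
    where
    link : ∀ {x y} → x ∈ ends u → y ∈ verts I → P x y →
           ∃[ p ] (Ordered p × Hits (verts I) p) × Hits (ends u) p ×
                  Within (verts I List.++ ends u) p
    link {x} {y} x∈u y∈I pxy
      with orient (λ { ≡.refl → I#uL (y∈I , ∈-++⁺ˡ x∈u) }) pxy
    ... | p , ordered , p↭ = p ,
      (ordered , y , ∈-resp-↭ (↭-sym p↭) (there (here ≡.refl)) , y∈I) ,
      (x , ∈-resp-↭ (↭-sym p↭) (here ≡.refl) , x∈u) ,
      λ _ z∈p → endpoint (∈-resp-↭ p↭ z∈p)
      where
      endpoint : ∀ {z} → z ∈ x ∷ y ∷ [] → z ∈ verts I List.++ ends u
      endpoint (here ≡.refl)         = ∈-++⁺ʳ (verts I) x∈u
      endpoint (there (here ≡.refl)) = ∈-++⁺ˡ y∈I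
    new : ∃[ w ] w ∈ I × Adjacent u w →
          ∃[ p ] (Ordered p × Hits (verts I) p) × Hits (ends u) p ×
                 Within (verts I List.++ ends u) p
    new (w , w∈I , inj₁ ead) = link (here ≡.refl) (∈-verts (there (here ≡.refl)) w∈I) (E⇒P ead)
    new (w , w∈I , inj₂ ecb) =
      link (there (here ≡.refl)) (∈-verts (here ≡.refl) w∈I) (P-sym (E⇒P ecb))

  -- A count in the style of Turán's theorem.

  module _ (r : ℕ) (bound : ∀ I → All (uncurry E) I → AllPairs NonAdjacent I → length I ≤ r) where

    -- The induction step of the count, with `i` and `l` the sizes of the two parts. Adding `i`
    -- squared on the left leaves `2 i (i + l)` plus `l` squared, and both terms are within their
    -- bounds.
    peel-bound : ∀ i l e → i ≤ r → l ℕ.* l ≤ 2 ℕ.* r ℕ.* e →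
                 (i ℕ.+ l) ℕ.* (i ℕ.+ l) ≤ 2 ℕ.* r ℕ.* (i ℕ.+ (l ℕ.+ e))
    peel-bound i l e i≤r l²≤ = begin
      (i ℕ.+ l) ℕ.* (i ℕ.+ l)
        ≤⟨ ℕ.m≤m+n _ (i ℕ.* i) ⟩
      (i ℕ.+ l) ℕ.* (i ℕ.+ l) ℕ.+ i ℕ.* i
        ≡⟨ solve 2 (λ i l → (i :+ l) :* (i :+ l) :+ i :* i := con 2 :* i :* (i :+ l) :+ l :* l)
             ≡.refl i l ⟩
      2 ℕ.* i ℕ.* (i ℕ.+ l) ℕ.+ l ℕ.* l
        ≤⟨ ℕ.+-mono-≤ (ℕ.*-monoˡ-≤ (i ℕ.+ l) (ℕ.*-monoʳ-≤ 2 i≤r)) l²≤ ⟩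
      2 ℕ.* r ℕ.* (i ℕ.+ l) ℕ.+ 2 ℕ.* r ℕ.* e
        ≡⟨ solve 4 (λ r i l e → con 2 :* r :* (i :+ l) :+ con 2 :* r :* e :=
                                con 2 :* r :* (i :+ (l :+ e))) ≡.refl r i l e ⟩
      2 ℕ.* r ℕ.* (i ℕ.+ (l ℕ.+ e)) ∎
      where open ℕ.≤-Reasoning
            open +-*-Solver

    -- Each step splits M into a maximal independent I, so that |I| ≤ r, and the rest
    -- L. Every member of I spans an ordered pair and every member of L sends one to
    -- I; none of these |I| + |L| pairs lies inside L.
    many-pairs : ∀ fuel M → length M ≤ fuel → Unique (verts M) → All (uncurry E) M →
      ∃[ ps ] Unique ps × All Ordered ps × All (Within (verts M)) ps ×
              length M ℕ.* length M ≤ 2 ℕ.* r ℕ.* length ps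
    many-pairs _ [] _ _ _ = [] , [] , [] , [] , ℕ.z≤n
    many-pairs (suc fuel) M@(_ ∷ _) |M|≤ uM eM with maximal-independent M eM
    ... | I , L , M↭ , len , eI , eL , ind , adj , nonempty
      with unique-++⁻ (verts I) (Unique-resp-↭ (≡.setoid _) (↭.↭⇒↭ₛ M↭) uM)
    ... | uI , uL , I#L
      with many-pairs fuel L (ℕ.≤-pred (ℕ.≤-trans
             (ℕ.+-monoˡ-≤ (length L) (ℕ.n≢0⇒n>0 λ i≡0 → contradiction (nonempty i≡0) λ ()))
             (ℕ.≤-trans (ℕ.≤-reflexive (≡.sym len)) |M|≤))) uL eL
         | pick {Ordered} [] I uI (λ ()) (inner-pairs I uI eI)
         | pick {λ p → Ordered p × Hits (verts I) p} (verts I) L uL I#L (cross-pairs I L I#L adj)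
    ... | ps₃ , u₃ , ordered₃ , within₃ , bound₃
        | ps₁ , len₁ , u₁ , good₁
        | ps₂ , len₂ , u₂ , good₂ =
      ps₁ List.++ ps₂ List.++ ps₃ ,
      Unique.++⁺ u₁ (Unique.++⁺ u₂ u₃ ps₂#ps₃) ps₁#ps₂₃ ,
      All.++⁺ (All.map proj₁ good₁)
        (All.++⁺ (All.map (proj₁ ∘ proj₁) good₂) ordered₃) ,
      All.map (λ within x x∈p → ∈-resp-↭ (↭-sym M↭) (within x x∈p))
        (All.++⁺ (All.map (λ (_ , _ , p⊆I) x x∈p → ∈-++⁺ˡ (p⊆I x x∈p)) good₁)
          (All.++⁺ (All.map (λ (_ , _ , p⊆IL) → p⊆IL) good₂)
                   (All.map (λ p⊆L x x∈p → ∈-++⁺ʳ (verts I) (p⊆L x x∈p)) within₃))) ,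
      square-bound
      where
      ps₂#ps₃ : Disjoint ps₂ ps₃
      ps₂#ps₃ (p∈ps₂ , p∈ps₃) with All.lookup good₂ p∈ps₂
      ... | (_ , x , x∈p , x∈I) , _ = I#L (x∈I , All.lookup within₃ p∈ps₃ x x∈p)

      -- Inner pairs lie inside `I`, while cross pairs have an end in `L` and the recursive pairs
      -- lie inside `L`.
      ps₁#ps₂₃ : Disjoint ps₁ (ps₂ List.++ ps₃)
      ps₁#ps₂₃ (p∈ps₁ , p∈) with All.lookup good₁ p∈ps₁ | ∈-++⁻ ps₂ p∈
      ... | _ , (x , x∈p , x∈I) , _ | inj₂ p∈ps₃ = I#L (x∈I , All.lookup within₃ p∈ps₃ x x∈p)
      ... | _ , _ , p⊆I | inj₁ p∈ps₂ with All.lookup good₂ p∈ps₂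
      ...   | _ , (x , x∈p , x∈L) , _ = I#L (p⊆I x x∈p , x∈L)

      square-bound : length M ℕ.* length M ≤ 2 ℕ.* r ℕ.* length (ps₁ List.++ ps₂ List.++ ps₃)
      square-bound = ≡.subst₂ _≤_ (≡.sym (≡.cong₂ ℕ._*_ len len)) (≡.cong (2 ℕ.* r ℕ.*_) count)
        (peel-bound (length I) (length L) (length ps₃) (bound I eI ind) bound₃)
        where
        count : length I ℕ.+ (length L ℕ.+ length ps₃) ≡ length (ps₁ List.++ ps₂ List.++ ps₃)
        count = ≡.sym (≡.trans (length-++ ps₁)
                  (≡.cong₂ ℕ._+_ len₁ (≡.trans (length-++ ps₂) (≡.cong (ℕ._+ length ps₃) len₂))))

-- The function `g` is twice the integer square root of `c f(n)`, the factor 2 accounting for the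
-- two ends of each matching edge.
√-=o : ∀ {f} → f =o (λ n → n ^ 2) → ∀ c →
       Σ[ g ∈ (ℕ → ℕ) ] (g =o (λ n → n)) × (∀ n m → m ℕ.* m ≤ c ℕ.* f n → 2 ℕ.* m ≤ g n)
√-=o {f} f=o c = (λ n → 2 ℕ.* q n) , small , λ n m m²≤ → ℕ.*-monoʳ-≤ 2 (proj₂ (proj₂ (√-bounds _)) m m²≤)
  where
  q : ℕ → ℕ
  q n = proj₁ (√-bounds (c ℕ.* f n))
  small : (λ n → 2 ℕ.* q n) =o (λ n → n)
  -- For `suc k` times `2 q` to be at most `n`, it suffices after squaring that
  -- `(2 (k + 1))² c f(n)` is at most `n²`, which dictates this tolerance.
  small k with f=o (suc k ℕ.* 2 ℕ.* (suc k ℕ.* 2) ℕ.* c)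
  ... | N , f≤ = N , λ n N≤n → m²≤n²⇒m≤n (begin
    suc k ℕ.* (2 ℕ.* q n) ℕ.* (suc k ℕ.* (2 ℕ.* q n))
      ≡⟨ solve 2 (λ k q → k :* (con 2 :* q) :* (k :* (con 2 :* q)) :=
                          k :* con 2 :* (k :* con 2) :* (q :* q)) ≡.refl (suc k) (q n) ⟩
    C ℕ.* (q n ℕ.* q n)        ≤⟨ ℕ.*-monoʳ-≤ C (proj₁ (proj₂ (√-bounds (c ℕ.* f n)))) ⟩
    C ℕ.* (c ℕ.* f n)          ≡⟨ ℕ.*-assoc C c (f n) ⟨
    C ℕ.* c ℕ.* f n            ≤⟨ ℕ.m≤n+m _ (f n) ⟩
    suc (C ℕ.* c) ℕ.* f n      ≤⟨ f≤ n N≤n ⟩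
    n ^ 2                      ≡⟨ ≡.cong (n ℕ.*_) (ℕ.*-identityʳ n) ⟩
    n ℕ.* n                    ∎)
    where
    open ℕ.≤-Reasoning
    open +-*-Solver
    C = suc k ℕ.* 2 ℕ.* (suc k ℕ.* 2)

-- Removal of the ends of a maximal matching of transversal pairs.

theorem5 : (em : ExcludedMiddle 0ℓ) (ℝ : CompleteOrderedField) → let open Flats ℝ in
    (d : ℕ) (f : ℕ → ℕ) → f =o (λ n → n ^ 2) →
    Σ[ g ∈ (ℕ → ℕ) ] (g =o (λ n → n)) ×
    ((n : ℕ) (A : Arrangement d n) → NoTwoParallel A →
    #pointPairs em A ≤ f n →
    Σ[ R ∈ Subset n ] (∣ R ∣ ≤ g n) ×
    (∀ i j → i ≢ j → i ∉ R → j ∉ R →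
    Satisfiable (flat A i ∩ flat A j) →
    DimensionAtLeastOne (flat A i ∩ flat A j)))
theorem5 em ℝ d f f=o = g , g=o , λ n A _ few → remove A few
  where
  open Flats ℝ
  open LinearAlgebra em ℝ

  2d≡d+d : 2 ℕ.* d ≡ d ℕ.+ d
  2d≡d+d = ≡.cong (d ℕ.+_) (ℕ.+-identityʳ d)

  r-bound = transversal-bound {d} 2d≡d+d
  r = proj₁ r-bound

  -- The constant is the factor from `many-pairs`, so `g` is fixed by `d` and `f` before any
  -- arrangement is given.
  √f = √-=o f=o (2 ℕ.* r)
  g = proj₁ √f
  g=o = proj₁ (proj₂ √f)

  remove : ∀ {n} (A : Arrangement d n) → #pointPairs em A ≤ f n →
           Σ[ R ∈ Subset n ] (∣ R ∣ ≤ g n) ×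
             (∀ i j → i ≢ j → i ∉ R → j ∉ R →
              Satisfiable (flat A i ∩ flat A j) →
              DimensionAtLeastOne (flat A i ∩ flat A j))
  remove {n} A few = fromList (verts M) , small , remaining
    where
    direction : Fin n → Vector (Space (2 ℕ.* d)) d
    direction i = directions {S = flat A i} (isFlat A i)

    E PointPair : Rel (Fin n) 0ℓ
    E i j = Transversal (direction i) (direction j)
    PointPair i j = IsFlat 0 (flat A i ∩ flat A j)

    PointPair-sym : Symmetric PointPair
    PointPair-sym (p , v , li , ∈⇔) = p , v , li , λ x → mk⇔
      (Equivalence.to (∈⇔ x) ∘ swap) (swap ∘ Equivalence.from (∈⇔ x))

    open Matchings em E PointPair
      (λ {i} {j} →
        transversal⇒point {S = flat A i} {T = flat A j} (isFlat A i) (isFlat A j) 2d≡d+d)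
      PointPair-sym

    matching = maximal-matching (List.cartesianProduct (List.allFin n) (List.allFin n))
    M = proj₁ matching
    M-unique = proj₁ (proj₂ matching)
    M⊆E = proj₁ (proj₂ (proj₂ matching))
    M-maximal = proj₂ (proj₂ (proj₂ matching))

    independent-bound : ∀ I → All (uncurry E) I → AllPairs NonAdjacent I → length I ≤ r
    independent-bound I eI ind = proj₂ r-bound
      (λ k → direction (proj₁ (lookup I k))) (λ k → direction (proj₂ (lookup I k)))
      (λ k → All.lookup eI (∈-lookup k))
      -- A transversal pair from the first end of edge `k` to the second end of edge `l` is the
      -- first alternative of `Adjacent`; exchanging the alternatives shows that non-adjacency is
      -- symmetric.
      (λ k l k≢l e → allPairs-lookup {R = NonAdjacent} (λ ¬adj → ¬adj ∘ [ inj₂ , inj₁ ]′)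
                       ind k l k≢l (inj₁ e))

    count : ∀ {ps} → Unique ps → All Ordered ps → length ps ≤ #pointPairs em A
    count unique ordered = unique-⊆-length unique λ p∈ps →
      ∈-filter⁺ _ (∈-cartesianProduct⁺ (∈-allFin _) (∈-allFin _)) (All.lookup ordered p∈ps)

    square : length M ℕ.* length M ≤ 2 ℕ.* r ℕ.* f n
    square with many-pairs r independent-bound (length M) M ℕ.≤-refl M-unique M⊆E
    ... | ps , unique , ordered , _ , M²≤ =
      ℕ.≤-trans M²≤ (ℕ.*-monoʳ-≤ (2 ℕ.* r) (ℕ.≤-trans (count unique ordered) few))

    small : ∣ fromList (verts M) ∣ ≤ g n
    small = ℕ.≤-trans (∣fromList∣≤length (verts M))
      (ℕ.≤-trans (ℕ.≤-reflexive (length-verts M)) (proj₂ (proj₂ √f) n (length M) square))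

    remaining : ∀ i j → i ≢ j → i ∉ fromList (verts M) → j ∉ fromList (verts M) →
                Satisfiable (flat A i ∩ flat A j) → DimensionAtLeastOne (flat A i ∩ flat A j)
    remaining i j i≢j i∉R j∉R =
      ¬transversal⇒dimension≥1 {S = flat A i} {T = flat A j} (isFlat A i) (isFlat A j)
      -- If two remaining flats were transversal, maximality of the matching would put one of them
      -- among the removed vertices.
      λ e → [ i∉R ∘ ∈-fromList , j∉R ∘ ∈-fromList ]′
              (M-maximal (∈-cartesianProduct⁺ (∈-allFin i) (∈-allFin j)) i≢j e)
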